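{- Let $G_1$ and $G_2$ be broken sun graphs of orders $n_1$ and $n_2$ and girths $g_1$ and $g_2$, respectively, neither of which has a perfect matching. Suppose that $g_1\equiv g_2\equiv 0\pmod 4$ and that, in each of $G_1$ and $G_2$, there is an odd number of vertices of degree $2$ between any pair of consecutive vertices of degree $3$ (consecutive along the cycle). Then, for any one-edge connection $G=G_1\odot G_2$, the Laplacian matrix $L(G)$ has eigenvalue $2$.
   Context: All graphs are finite, undirected, with no loops or multiple edges. The Laplacian matrix of $G$ is $L(G)=D(G)-A(G)$, where $D(G)$ is the diagonal matrix of vertex degrees and $A(G)$ is the adjacency matrix. A unicyclic graph is a connected graph whose number of edges equals its number of vertices. The sun graph of order $2m$ ($m\ge 3$) is the cycle $C_m$ with one pendant vertex attached to each vertex of the cycle. A broken sun graph is a unicyclic subgraph of a sun graph; its girth is the length of its unique cycle, and its cycle vertices have degree $2$ or $3$. In the hypothesis, degrees are taken in $G_1$ (respectively $G_2$), not in $G$. A one-edge connection $G_1\odot G_2$ of two (vertex-disjoint) graphs $G_1,G_2$ is any graph $G$ with $V(G)=V(G_1)\cup V(G_2)$ and $E(G)=E(G_1)\cup E(G_2)\cup\{uv\}$ for some $u\in V(G_1)$ and $v\in V(G_2)$. -}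

module Defs where

open import Data.Bool.Base using (if_then_else_)
open import Data.Empty using (⊥)
open import Data.Fin.Base using (Fin; toℕ; splitAt)
open import Data.Fin.Properties using (toℕ<n; toℕ-fromℕ<) renaming (_≟_ to _≟ᶠ_; _<?_ to _<ᶠ?_)
open import Data.Integer.Base using (+_)
open import Data.List.Base using (length; filter; allFin; cartesianProduct)
open import Data.Nat.Base using (ℕ; suc; _+_; _≤_; _<_; s≤s)
open import Data.Nat.DivMod using (_%_; _mod_; m<n⇒m%n≡m; n%n≡0; m%n<n)
open import Data.Nat.Properties using (_≟_; +-comm; m≤n⇒m<n∨m≡n; 1+n≢n; suc-injective; m<n⇒n≢0)
open import Data.Product.Base using (Σ-syntax; ∃-syntax; _×_; _,_)
open import Data.Product using (∃!)
open import Data.Rational.Base using (ℚ; 0ℚ; 1ℚ; _-_; _*_; _/_)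
open import Data.Rational.Properties using (+-0-commutativeMonoid)
open import Algebra.Properties.CommutativeMonoid.Sum +-0-commutativeMonoid using (sum)
open import Data.Sum.Base using (_⊎_; inj₁; inj₂; swap)
open import Data.Vec.Functional using (Vector)
open import Function.Base using (id)
open import Function.Definitions using (Injective)
open import Level using (0ℓ)
open import Relation.Binary.Construct.Closure.ReflexiveTransitive using (Star)
open import Relation.Binary.Core using (Rel)
open import Relation.Binary.Definitions using (Decidable; DecidableEquality; Symmetric)
open import Relation.Binary.PropositionalEquality using (_≡_; _≢_; sym; trans; cong)
open import Relation.Nullary using (¬_; no; does)
open import Relation.Nullary.Decidable using (_×-dec_; _⊎-dec_)
open import Relation.Unary using (Pred) renaming (Decidable to Decidable₁)

record Graph (V : Set) : Set₁ where
  field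
    Adj      : Rel V 0ℓ
    adj?     : Decidable Adj
    adj-sym  : Symmetric Adj
    loopless : ∀ {v} → ¬ Adj v v

open Graph public

-- The graph on W in which x and y are adjacent exactly when f x and f y are.
-- It is only used to transport a graph along a bijection W ≅ V.
comap : ∀ {V W : Set} → (W → V) → Graph V → Graph W
comap f G .Adj x y    = Adj G (f x) (f y)
comap f G .adj? x y   = adj? G (f x) (f y)
comap f G .adj-sym a  = adj-sym G a
comap f G .loopless a = loopless G a

-- H is isomorphic to a (not necessarily induced) subgraph of G.
record Embedding {V W : Set} (H : Graph V) (G : Graph W) : Set where
  field
    to        : V → W
    injective : Injective _≡_ _≡_ to
    preserves : ∀ {x y} → Adj H x y → Adj G (to x) (to y)

open Embedding public

count : ∀ {n} {P : Pred (Fin n) 0ℓ} → Decidable₁ P → ℕ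
count {n} P? = length (filter P? (allFin n))

degree : ∀ {n} → Graph (Fin n) → Fin n → ℕ
degree G v = count (adj? G v)

-- Each edge {i , j} is counted once, as the pair (i , j) with i < j.
edgeCount : ∀ {n} → Graph (Fin n) → ℕ
edgeCount {n} G =
  length (filter (λ (i , j) → (i <ᶠ? j) ×-dec adj? G i j)
                 (cartesianProduct (allFin n) (allFin n)))

Connected : ∀ {V} → Graph V → Set
Connected {V} G = V × (∀ x y → Star (Adj G) x y)

Unicyclic : ∀ {n} → Graph (Fin n) → Set
Unicyclic {n} G = Connected G × edgeCount G ≡ n

-- Mate x y says that the edge xy belongs to the matching.
record PerfectMatching {V : Set} (G : Graph V) : Set₁ where
  field
    Mate     : Rel V 0ℓ
    mate-sym : Symmetric Mate
    mate-adj : ∀ {x y} → Mate x y → Adj G x y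
    saturate : ∀ x → ∃! _≡_ (Mate x)

infixl 6 _⊕_

-- Cyclic shift: i + k modulo m.
_⊕_ : ∀ {m} → Fin m → ℕ → Fin m
_⊕_ {suc m} i k = (toℕ i + k) mod suc m

i≢i⊕1 : ∀ {m} → 3 ≤ m → (i : Fin m) → i ≢ i ⊕ 1
i≢i⊕1 {suc m} (s≤s 2≤m) i i≡i⊕1 with m≤n⇒m<n∨m≡n (toℕ<n i)
  | trans (cong toℕ i≡i⊕1)
      (trans (toℕ-fromℕ< (m%n<n (toℕ i + 1) (suc m)))
             (cong (_% suc m) (+-comm (toℕ i) 1)))
... | inj₁ 1+i<1+m | i≡[1+i]% = 1+n≢n (sym (trans i≡[1+i]% (m<n⇒m%n≡m 1+i<1+m)))
... | inj₂ 1+i≡1+m | i≡[1+i]% = m<n⇒n≢0 2≤m (trans (sym (suc-injective 1+i≡1+m))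
    (trans i≡[1+i]% (trans (cong (_% suc m) 1+i≡1+m) (n%n≡0 (suc m)))))

CycleAdj : ∀ {m} → Rel (Fin m) 0ℓ
CycleAdj i j = j ≡ i ⊕ 1 ⊎ i ≡ j ⊕ 1

cycleGraph : ∀ m → 3 ≤ m → Graph (Fin m)
cycleGraph m 3≤m .Adj                = CycleAdj
cycleGraph m 3≤m .adj? i j           = (j ≟ᶠ i ⊕ 1) ⊎-dec (i ≟ᶠ j ⊕ 1)
cycleGraph m 3≤m .adj-sym            = swap
cycleGraph m 3≤m .loopless (inj₁ eq) = i≢i⊕1 3≤m _ eq
cycleGraph m 3≤m .loopless (inj₂ eq) = i≢i⊕1 3≤m _ eq

-- inj₁ i is the i-th vertex of the cycle and inj₂ i the pendant vertex attached to it.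
SunAdj : ∀ {m} → Rel (Fin m ⊎ Fin m) 0ℓ
SunAdj (inj₁ i) (inj₁ j) = CycleAdj i j
SunAdj (inj₁ i) (inj₂ j) = i ≡ j
SunAdj (inj₂ i) (inj₁ j) = i ≡ j
SunAdj (inj₂ i) (inj₂ j) = ⊥

sun : ∀ m → 3 ≤ m → Graph (Fin m ⊎ Fin m)
sun m 3≤m .Adj = SunAdj
sun m 3≤m .adj? (inj₁ i) (inj₁ j) = adj? (cycleGraph m 3≤m) i j
sun m 3≤m .adj? (inj₁ i) (inj₂ j) = i ≟ᶠ j
sun m 3≤m .adj? (inj₂ i) (inj₁ j) = i ≟ᶠ j
sun m 3≤m .adj? (inj₂ i) (inj₂ j) = no λ ()
sun m 3≤m .adj-sym {inj₁ i} {inj₁ j} = swap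
sun m 3≤m .adj-sym {inj₁ i} {inj₂ j} = sym
sun m 3≤m .adj-sym {inj₂ i} {inj₁ j} = sym
sun m 3≤m .loopless {inj₁ i} = loopless (cycleGraph m 3≤m)

BrokenSun : ∀ {n} → Graph (Fin n) → Set
BrokenSun G = Unicyclic G × ∃[ m ] Σ[ 3≤m ∈ 3 ≤ m ] Embedding G (sun m 3≤m)

-- A cycle of length g in G, with a chosen starting vertex and orientation.
-- In a unicyclic graph it is unique up to this choice, and g is the girth.
record Cycle {V : Set} (G : Graph V) (g : ℕ) : Set where
  field
    3≤g       : 3 ≤ g
    embedding : Embedding (cycleGraph g 3≤g) G

  vertex : Fin g → V
  vertex = to embedding

open Cycle public

-- The cycle vertices at positions i and i ⊕ suc k are distinct since suc k < g,
-- and those strictly between them are at positions i ⊕ 1 , … , i ⊕ k.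
OddGaps : ∀ {n g} (G : Graph (Fin n)) → Cycle G g → Set
OddGaps {g = g} G c =
  ∀ (i : Fin g) (k : ℕ) → suc k < g →
  deg i ≡ 3 → deg (i ⊕ suc k) ≡ 3 →
  (∀ (j : Fin k) → deg (i ⊕ suc (toℕ j)) ≢ 3) →
  count {k} (λ j → deg (i ⊕ suc (toℕ j)) ≟ 2) % 2 ≡ 1
  where
  deg : Fin g → ℕ
  deg i = degree G (vertex c i)

module _ {V W : Set} (G₁ : Graph V) (G₂ : Graph W) (u : V) (v : W) where

  ConnectionAdj : Rel (V ⊎ W) 0ℓ
  ConnectionAdj (inj₁ x) (inj₁ y) = Adj G₁ x y
  ConnectionAdj (inj₁ x) (inj₂ y) = x ≡ u × y ≡ v
  ConnectionAdj (inj₂ x) (inj₁ y) = y ≡ u × x ≡ v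
  ConnectionAdj (inj₂ x) (inj₂ y) = Adj G₂ x y

  connection : DecidableEquality V → DecidableEquality W → Graph (V ⊎ W)
  connection _≟₁_ _≟₂_ .Adj = ConnectionAdj
  connection _≟₁_ _≟₂_ .adj? (inj₁ x) (inj₁ y) = adj? G₁ x y
  connection _≟₁_ _≟₂_ .adj? (inj₁ x) (inj₂ y) = (x ≟₁ u) ×-dec (y ≟₂ v)
  connection _≟₁_ _≟₂_ .adj? (inj₂ x) (inj₁ y) = (y ≟₁ u) ×-dec (x ≟₂ v)
  connection _≟₁_ _≟₂_ .adj? (inj₂ x) (inj₂ y) = adj? G₂ x y
  connection _≟₁_ _≟₂_ .adj-sym {inj₁ x} {inj₁ y} = adj-sym G₁
  connection _≟₁_ _≟₂_ .adj-sym {inj₁ x} {inj₂ y} = id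
  connection _≟₁_ _≟₂_ .adj-sym {inj₂ x} {inj₁ y} = id
  connection _≟₁_ _≟₂_ .adj-sym {inj₂ x} {inj₂ y} = adj-sym G₂
  connection _≟₁_ _≟₂_ .loopless {inj₁ x} = loopless G₁
  connection _≟₁_ _≟₂_ .loopless {inj₂ x} = loopless G₂

-- The first n₁ vertices are those of G₁, the last n₂ those of G₂.
oneEdgeConnection : ∀ {n₁ n₂} → Graph (Fin n₁) → Graph (Fin n₂) →
                    Fin n₁ → Fin n₂ → Graph (Fin (n₁ + n₂))
oneEdgeConnection {n₁} G₁ G₂ u v =
  comap (splitAt n₁) (connection G₁ G₂ u v _≟ᶠ_ _≟ᶠ_)

Matrix : ℕ → Set
Matrix n = Fin n → Vector ℚ n

fromℕ : ℕ → ℚ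
fromℕ k = + k / 1

degreeMatrix : ∀ {n} → Graph (Fin n) → Matrix n
degreeMatrix G i j = if does (i ≟ᶠ j) then fromℕ (degree G i) else 0ℚ

adjacencyMatrix : ∀ {n} → Graph (Fin n) → Matrix n
adjacencyMatrix G i j = if does (adj? G i j) then 1ℚ else 0ℚ

laplacian : ∀ {n} → Graph (Fin n) → Matrix n
laplacian G i j = degreeMatrix G i j - adjacencyMatrix G i j

infixr 7 _*ᵥ_

_*ᵥ_ : ∀ {n} → Matrix n → Vector ℚ n → Vector ℚ n
(M *ᵥ x) i = sum (λ j → M i j * x j)

-- For a rational matrix and a rational scalar, a nonzero rational eigenvector
-- exists exactly when a nonzero real one does.
IsEigenvalue : ∀ {n} → Matrix n → ℚ → Set
IsEigenvalue {n} M μ =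
  Σ[ x ∈ Vector ℚ n ] (∃[ i ] x i ≢ 0ℚ) × (∀ i → (M *ᵥ x) i ≡ μ * x i)

{-# OPTIONS --safe #-}

-- Number the vertices of the cycle of a broken sun from a vertex of degree 3 (from any vertex,
-- if there is none).  As the gaps are odd, all vertices of degree 3 sit at even positions, so
-- those at odd positions have no neighbours off the cycle.  Since 4 divides the girth, the signs
-- 1 , -1 , 1 , -1 , … can be placed on the odd positions; with 0 at all other vertices this is an
-- eigenvector for the eigenvalue 2.  The eigenvectors x₁ of L(G₁) and x₂ of L(G₂) so obtained can
-- be rescaled to agree at the ends u and v of the connecting edge (taking 0 for x₂ if x₁ vanishes
-- at u), and then this edge contributes nothing to L(G)x.

module Submission where

open import Defs
open import Algebra.Bundles using (CommutativeRing)
import Algebra.Properties.Group as GroupProperties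
open import Data.Bool.Base using (if_then_else_)
open import Data.Fin.Base using (Fin; zero; suc; toℕ; splitAt; _↑ˡ_; _↑ʳ_)
open import Data.Fin.Patterns using (0F; 1F; 2F)
open import Data.Fin.Properties
  using (toℕ<n; toℕ-fromℕ<; toℕ-injective; injective⇒≤; any?; splitAt-↑ˡ; splitAt-↑ʳ)
  renaming (_≟_ to _≟ᶠ_)
import Data.Integer.Base as ℤ
import Data.Integer.Properties as ℤ
open import Data.List.Base using (_∷_; length; filter; allFin; tabulate; lookup)
open import Data.List.Membership.Propositional using (_∈_)
open import Data.List.Membership.Propositional.Properties using (∈-filter⁺; ∈-filter⁻; ∈-allFin; ∈-lookup)
open import Data.List.Properties using (filter-all; length-tabulate)
open import Data.List.Relation.Unary.All as All using (universal)
open import Data.List.Relation.Unary.AllPairs using (_∷_)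
open import Data.List.Relation.Unary.Any using (index)
open import Data.List.Relation.Unary.Any.Properties using (lookup-index)
open import Data.List.Relation.Unary.Unique.Propositional using (Unique)
open import Data.List.Relation.Unary.Unique.Propositional.Properties using (allFin⁺; filter⁺)
open import Data.Nat.Base as ℕ using (ℕ; zero; suc; _+_; _≤_; _<_; s≤s; z≤n; NonZero)
open import Data.Nat.Coprimality as Coprimality using (1-coprimeTo)
open import Data.Nat.Divisibility using (_∣_; divides; divides-refl; ∣⇒≤; ∣m+n∣m⇒∣n; m%n≡0⇒n∣m)
open import Data.Nat.DivMod as ℕ
  using (_%_; m%n<n; m<n⇒m%n≡m; [m+n]%n≡m%n; m%n%n≡m%n; %-distribˡ-+; m≡m%n+[m/n]*n)
open import Data.Nat.Properties
  using (_≟_; +-assoc; +-comm; +-identityʳ; +-cancelˡ-≡; +-suc; ≤-antisym; ≤-pred; ≤-trans; ≤-reflexive;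
         <⇒≱; m≤n⇒m<n∨m≡n; m≤n+m; n<1+n; <-trans; ≤-refl)
open import Data.Product.Base using (∃-syntax; _×_; _,_; proj₁; proj₂)
open import Data.Rational.Base as ℚ using (ℚ; 0ℚ; 1ℚ; mkℚ; _/_; -_; _-_; 1/_; ≢-nonZero)
import Data.Rational.Properties as ℚ
open import Algebra.Properties.CommutativeMonoid.Sum ℚ.+-0-commutativeMonoid
  using (sum; sum-cong-≗; sum-replicate-zero; ∑-distrib-+; ∑-comm)
open import Algebra.Properties.Semiring.Sum (CommutativeRing.semiring ℚ.+-*-commutativeRing)
  using (*-distribˡ-sum; *-distribʳ-sum)
open import Data.Rational.Solver using (module +-*-Solver)
open import Data.Sum.Base using (_⊎_; inj₁; inj₂; [_,_]; map)
open import Data.Vec.Functional using (Vector)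
open import Function.Base using (_∘_; id)
open import Function.Definitions using (Injective)
open import Level using (0ℓ)
open import Relation.Binary.PropositionalEquality hiding ([_])
open import Relation.Nullary using (¬_; Dec; yes; no; does; contradiction)
open import Relation.Unary using (Pred) renaming (Decidable to Decidable₁)

private variable
  k m n : ℕ

-- Positions on a cycle

-- Equal remainders make `m` a divisor of `c`, and 0 is the only multiple of `m` below `m`.
+-%-cancelˡ : ∀ x {c m} .{{_ : NonZero m}} → c < m → (x + c) % m ≡ x % m → c ≡ 0
+-%-cancelˡ x {zero}      c<m eq = refl
+-%-cancelˡ x {c@(suc _)} {m} c<m eq = contradiction (∣⇒≤ m∣c) (<⇒≱ c<m)
  where
  m∣c : m ∣ c
  m∣c = ∣m+n∣m⇒∣n (divides ((x + c) ℕ./ m) (+-cancelˡ-≡ (x % m) _ _ (begin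
    x % m + (x ℕ./ m ℕ.* m + c)           ≡⟨ +-assoc (x % m) _ c ⟨
    x % m + x ℕ./ m ℕ.* m + c             ≡⟨ cong (_+ c) (m≡m%n+[m/n]*n x m) ⟨
    x + c                                 ≡⟨ m≡m%n+[m/n]*n (x + c) m ⟩
    (x + c) % m + (x + c) ℕ./ m ℕ.* m     ≡⟨ cong (_+ (x + c) ℕ./ m ℕ.* m) eq ⟩
    x % m + (x + c) ℕ./ m ℕ.* m           ∎)))
    (divides-refl (x ℕ./ m))
    where open ≡-Reasoning

toℕ-⊕ : ∀ (i : Fin (suc m)) k → toℕ (i ⊕ k) ≡ (toℕ i + k) % suc m
toℕ-⊕ {m} i k = toℕ-fromℕ< (m%n<n (toℕ i + k) (suc m))

⊕-assoc : ∀ (i : Fin (suc m)) a b → (i ⊕ a) ⊕ b ≡ i ⊕ (a + b)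
⊕-assoc {m} i a b = toℕ-injective (begin
  toℕ ((i ⊕ a) ⊕ b)                                  ≡⟨ toℕ-⊕ (i ⊕ a) b ⟩
  (toℕ (i ⊕ a) + b) % suc m                          ≡⟨ cong (λ r → (r + b) % suc m) (toℕ-⊕ i a) ⟩
  ((toℕ i + a) % suc m + b) % suc m                  ≡⟨ %-distribˡ-+ ((toℕ i + a) % suc m) b (suc m) ⟩
  ((toℕ i + a) % suc m % suc m + b % suc m) % suc m  ≡⟨ cong (λ r → (r + b % suc m) % suc m)
                                                           (m%n%n≡m%n (toℕ i + a) (suc m)) ⟩
  ((toℕ i + a) % suc m + b % suc m) % suc m          ≡⟨ %-distribˡ-+ (toℕ i + a) b (suc m) ⟨
  (toℕ i + a + b) % suc m                            ≡⟨ cong (_% suc m) (+-assoc (toℕ i) a b) ⟩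
  (toℕ i + (a + b)) % suc m                          ≡⟨ toℕ-⊕ i (a + b) ⟨
  toℕ (i ⊕ (a + b))                                  ∎)
  where open ≡-Reasoning

⊕-identityʳ : ∀ (i : Fin (suc m)) → i ⊕ 0 ≡ i
⊕-identityʳ {m} i = toℕ-injective (begin
  toℕ (i ⊕ 0)          ≡⟨ toℕ-⊕ i 0 ⟩
  (toℕ i + 0) % suc m  ≡⟨ cong (_% suc m) (+-identityʳ (toℕ i)) ⟩
  toℕ i % suc m        ≡⟨ m<n⇒m%n≡m (toℕ<n i) ⟩
  toℕ i                ∎)
  where open ≡-Reasoning

⊕-period : ∀ (i : Fin (suc m)) k → i ⊕ (suc m + k) ≡ i ⊕ k
⊕-period {m} i k = toℕ-injective (begin
  toℕ (i ⊕ (suc m + k))          ≡⟨ toℕ-⊕ i (suc m + k) ⟩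
  (toℕ i + (suc m + k)) % suc m  ≡⟨ cong (λ r → (toℕ i + r) % suc m) (+-comm (suc m) k) ⟩
  (toℕ i + (k + suc m)) % suc m  ≡⟨ cong (_% suc m) (+-assoc (toℕ i) k (suc m)) ⟨
  (toℕ i + k + suc m) % suc m    ≡⟨ [m+n]%n≡m%n (toℕ i + k) (suc m) ⟩
  (toℕ i + k) % suc m            ≡⟨ toℕ-⊕ i k ⟨
  toℕ (i ⊕ k)                    ∎)
  where open ≡-Reasoning

-- Used to tell cycle vertices apart: a nonzero difference of offsets below the length of the cycle
-- cannot wrap round to the same position.
⊕-cancelˡ : ∀ (i : Fin (suc m)) a {c} → c < suc m → i ⊕ (a + c) ≡ i ⊕ a → c ≡ 0
⊕-cancelˡ {m} i a {c} c<m eq = +-%-cancelˡ (toℕ i + a) c<m (begin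
  (toℕ i + a + c) % suc m    ≡⟨ cong (_% suc m) (+-assoc (toℕ i) a c) ⟩
  (toℕ i + (a + c)) % suc m  ≡⟨ toℕ-⊕ i (a + c) ⟨
  toℕ (i ⊕ (a + c))          ≡⟨ cong toℕ eq ⟩
  toℕ (i ⊕ a)                ≡⟨ toℕ-⊕ i a ⟩
  (toℕ i + a) % suc m        ∎)
  where open ≡-Reasoning

-- In `Fin (suc m)` a further shift by `m` completes a full turn, so it undoes the shift by 1.
⊕1-injective : ∀ {i j : Fin m} → i ⊕ 1 ≡ j ⊕ 1 → i ≡ j
⊕1-injective {suc m} {i} {j} eq = trans (sym (back i)) (trans (cong (_⊕ m) eq) (back j))
  where
  back : ∀ (i : Fin (suc m)) → (i ⊕ 1) ⊕ m ≡ i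
  back i = trans (⊕-assoc i 1 m)
    (trans (cong (i ⊕_) (sym (+-identityʳ (suc m)))) (trans (⊕-period i 0) (⊕-identityʳ i)))

-- Degrees

Unique⇒lookup-injective : ∀ {A : Set} {xs} → Unique {A = A} xs → Injective _≡_ _≡_ (lookup xs)
Unique⇒lookup-injective (_ ∷ _)  {zero}  {zero}  eq = refl
Unique⇒lookup-injective {xs = _ ∷ xs} (x∉ ∷ _) {zero} {suc j} eq =
  contradiction eq (All.lookup x∉ (∈-lookup {xs = xs} j))
Unique⇒lookup-injective {xs = _ ∷ xs} (x∉ ∷ _) {suc i} {zero} eq =
  contradiction (sym eq) (All.lookup x∉ (∈-lookup {xs = xs} i))
Unique⇒lookup-injective (_ ∷ u)  {suc i} {suc j} eq = cong suc (Unique⇒lookup-injective u eq)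

module _ {P : Pred (Fin n) 0ℓ} (P? : Decidable₁ P) where

  count-all : (∀ j → P j) → count P? ≡ n
  count-all p = trans (cong length (filter-all P? (universal p (allFin n)))) (length-tabulate id)

  -- The index of `f i` in the filtered list is injective in `i`, because looking it up returns
  -- `f i`.
  ≤-count : (f : Fin k → Fin n) → Injective _≡_ _≡_ f → (∀ i → P (f i)) → k ≤ count P?
  ≤-count f f-inj p = injective⇒≤ {f = λ i → index (f∈ i)} λ {i} {j} eq →
    f-inj (trans (lookup-index (f∈ i))
      (trans (cong (lookup (filter P? (allFin n))) eq) (sym (lookup-index (f∈ j)))))
    where
    f∈ : ∀ i → f i ∈ filter P? (allFin n)
    f∈ i = ∈-filter⁺ P? (∈-allFin (f i)) (p i)

  -- The entries of the filtered list are distinct, so `h` injects its indices into `Fin k`. As `h`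
  -- takes the proof of `P v`, a neighbour can be labelled by the way it is adjacent.
  count-≤ : (h : ∀ {v} → P v → Fin k) → (∀ {v w} (p : P v) (q : P w) → h p ≡ h q → v ≡ w) →
            count P? ≤ k
  count-≤ h h-inj = injective⇒≤ {f = h ∘ holds} λ {i} {j} eq →
    Unique⇒lookup-injective {xs = filter P? (allFin n)} (filter⁺ P? (allFin⁺ n)) (h-inj (holds i) (holds j) eq)
    where
    holds : ∀ i → P (lookup (filter P? (allFin n)) i)
    holds i = proj₂ (∈-filter⁻ P? {xs = allFin n} (∈-lookup {xs = filter P? (allFin n)} i))

  2≤count : ∀ {a b} → P a → P b → a ≢ b → 2 ≤ count P?
  2≤count {a} {b} pa pb a≢b = ≤-count f
    (λ { {0F} {0F} _  → refl
       ; {0F} {1F} eq → contradiction eq a≢b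
       ; {1F} {0F} eq → contradiction (sym eq) a≢b
       ; {1F} {1F} _  → refl })
    λ { 0F → pa ; 1F → pb }
    where
    f : Fin 2 → Fin n
    f 0F = a
    f 1F = b

  3≤count : ∀ {a b c} → P a → P b → P c → a ≢ b → a ≢ c → b ≢ c → 3 ≤ count P?
  3≤count {a} {b} {c} pa pb pc a≢b a≢c b≢c = ≤-count f
    (λ { {0F} {0F} _  → refl
       ; {0F} {1F} eq → contradiction eq a≢b
       ; {0F} {2F} eq → contradiction eq a≢c
       ; {1F} {0F} eq → contradiction (sym eq) a≢b
       ; {1F} {1F} _  → refl
       ; {1F} {2F} eq → contradiction eq b≢c
       ; {2F} {0F} eq → contradiction (sym eq) a≢c
       ; {2F} {1F} eq → contradiction (sym eq) b≢c
       ; {2F} {2F} _  → refl })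
    λ { 0F → pa ; 1F → pb ; 2F → pc }
    where
    f : Fin 3 → Fin n
    f 0F = a
    f 1F = b
    f 2F = c

  count≡2⇒ : count P? ≡ 2 → ∀ {a b c} → P a → P b → a ≢ b → P c → c ≡ a ⊎ c ≡ b
  count≡2⇒ eq {a} {b} {c} pa pb a≢b pc with c ≟ᶠ a | c ≟ᶠ b
  ... | yes c≡a | _       = inj₁ c≡a
  ... | no _    | yes c≡b = inj₂ c≡b
  ... | no c≢a  | no c≢b  =
    contradiction (≤-reflexive eq) (<⇒≱ (3≤count pa pb pc a≢b (≢-sym c≢a) (≢-sym c≢b)))

-- The labels, as seen from `a`: forward along the cycle, back along the cycle, pendant. A label
-- determines the other end, which bounds the degrees in a sun by 3.
sunEdgeType : ∀ {a b : Fin m ⊎ Fin m} → SunAdj a b → Fin 3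
sunEdgeType {a = inj₁ i} {inj₁ j} (inj₁ _) = 0F
sunEdgeType {a = inj₁ i} {inj₁ j} (inj₂ _) = 1F
sunEdgeType {a = inj₁ i} {inj₂ j} _        = 2F
sunEdgeType {a = inj₂ i} {inj₁ j} _        = 2F

sunEdgeType-injective : ∀ {a b b′ : Fin m ⊎ Fin m} (p : SunAdj a b) (q : SunAdj a b′) →
                        sunEdgeType {a = a} {b} p ≡ sunEdgeType {a = a} {b′} q → b ≡ b′
sunEdgeType-injective {a = inj₁ i} {inj₁ j} {inj₁ j′} (inj₁ p) (inj₁ q) _ = cong inj₁ (trans p (sym q))
sunEdgeType-injective {a = inj₁ i} {inj₁ j} {inj₁ j′} (inj₂ p) (inj₂ q) _ =
  cong inj₁ (⊕1-injective (trans (sym p) q))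
sunEdgeType-injective {a = inj₁ i} {inj₁ j} {inj₂ j′} (inj₁ _) _ ()
sunEdgeType-injective {a = inj₁ i} {inj₁ j} {inj₂ j′} (inj₂ _) _ ()
sunEdgeType-injective {a = inj₁ i} {inj₂ j} {inj₁ j′} _ (inj₁ _) ()
sunEdgeType-injective {a = inj₁ i} {inj₂ j} {inj₁ j′} _ (inj₂ _) ()
sunEdgeType-injective {a = inj₁ i} {inj₂ j} {inj₂ j′} p q _ = cong inj₂ (trans (sym p) q)
sunEdgeType-injective {a = inj₂ i} {inj₁ j} {inj₁ j′} p q _ = cong inj₁ (trans (sym p) q)

BrokenSun⇒degree≤3 : (G : Graph (Fin n)) → BrokenSun G → ∀ v → degree G v ≤ 3
BrokenSun⇒degree≤3 G (_ , m , 3≤m , e) v = count-≤ (adj? G v)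
  (λ {w} p → sunEdgeType {a = to e v} {to e w} (preserves e p))
  λ p q eq → injective e (sunEdgeType-injective {a = to e v} (preserves e p) (preserves e q) eq)

-- Laplacians

open +-*-Solver
open GroupProperties ℚ.+-0-group using ()
  renaming (∙-cancelʳ to +-cancelʳ; ⁻¹-involutive to neg-involutive)

fromℕ-suc : ∀ k → fromℕ (suc k) ≡ 1ℚ ℚ.+ fromℕ k
fromℕ-suc k = sym (begin
  1ℚ ℚ.+ fromℕ k                 ≡⟨ cong (1ℚ ℚ.+_) (ℚ.↥p/↧p≡p q) ⟩
  1ℚ ℚ.+ q                       ≡⟨⟩
  (ℤ.1ℤ ℤ.+ ℤ.+ k ℤ.* ℤ.1ℤ) / 1  ≡⟨ cong (λ z → (ℤ.1ℤ ℤ.+ z) / 1) (ℤ.*-identityʳ (ℤ.+ k)) ⟩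
  fromℕ (suc k)                  ∎)
  where
  open ≡-Reasoning
  -- For a variable `k` the fraction `fromℕ k` is stuck on a gcd; its explicit lowest-terms form `q`
  -- lets the addition compute.
  q : ℚ
  q = mkℚ (ℤ.+ k) 0 (Coprimality.sym (1-coprimeTo k))

indicator : ∀ {P : Set} → Dec P → ℚ
indicator P? = if does P? then 1ℚ else 0ℚ

indicator-true : ∀ {P : Set} (P? : Dec P) → P → indicator P? ≡ 1ℚ
indicator-true (yes _) p = refl
indicator-true (no ¬p) p = contradiction p ¬p

indicator-false : ∀ {P : Set} (P? : Dec P) → ¬ P → indicator P? ≡ 0ℚ
indicator-false (yes p) ¬p = contradiction p ¬p
indicator-false (no _)  ¬p = refl

fromℕ-count : {P : Pred (Fin n) 0ℓ} (P? : Decidable₁ P) →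
              fromℕ (count P?) ≡ sum (λ j → indicator (P? j))
fromℕ-count P? = go P? id
  where
  -- `allFin` is `tabulate id`, but the tail tabulates `id ∘ suc`, so the induction runs over
  -- arbitrary `f`.
  go : ∀ {n k} {P : Pred (Fin n) 0ℓ} (P? : Decidable₁ P) (f : Fin k → Fin n) →
       fromℕ (length (filter P? (tabulate f))) ≡ sum (λ j → indicator (P? (f j)))
  go {k = zero}  P? f = refl
  go {k = suc k} P? f with P? (f zero)
  ... | yes _ = trans (fromℕ-suc (length (filter P? (tabulate (f ∘ suc))))) (cong (1ℚ ℚ.+_) (go P? (f ∘ suc)))
  ... | no  _ = trans (go P? (f ∘ suc)) (sym (ℚ.+-identityˡ _))

sum-zero : {f : Vector ℚ n} → (∀ j → f j ≡ 0ℚ) → sum f ≡ 0ℚ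
sum-zero {n} f≡0 = trans (sum-cong-≗ f≡0) (sum-replicate-zero n)

δ : Fin n → Fin n → ℚ
δ i j = indicator (i ≟ᶠ j)

sum-δ : (f : Vector ℚ n) (q : Fin n) → sum (λ j → f j ℚ.* δ j q) ≡ f q
sum-δ {suc n} f zero = trans (cong₂ ℚ._+_ (ℚ.*-identityʳ (f zero)) (sum-zero (ℚ.*-zeroʳ ∘ f ∘ suc)))
                             (ℚ.+-identityʳ _)
sum-δ {suc n} f (suc q) = trans (cong₂ ℚ._+_ (ℚ.*-zeroʳ (f zero)) (sum-δ (f ∘ suc) q))
                                (ℚ.+-identityˡ _)

sum-splitAt : ∀ n₁ {n₂} (h : Fin n₁ ⊎ Fin n₂ → ℚ) →
              sum (λ j → h (splitAt n₁ j)) ≡ sum (h ∘ inj₁) ℚ.+ sum (h ∘ inj₂)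
sum-splitAt zero     h = sym (ℚ.+-identityˡ _)
sum-splitAt (suc n₁) h = trans
  (cong (h (inj₁ zero) ℚ.+_) (sum-splitAt n₁ (h ∘ map suc id)))
  (sym (ℚ.+-assoc (h (inj₁ zero)) _ _))

-- The degree is a row sum of the adjacency matrix, so the diagonal term spreads over the
-- neighbours. In this form an edge whose ends carry equal values contributes nothing.
laplacian-*ᵥ : (G : Graph (Fin n)) (x : Vector ℚ n) (i : Fin n) →
               (laplacian G *ᵥ x) i ≡ sum (λ j → adjacencyMatrix G i j ℚ.* (x i - x j))
-- Adding the sum of `Ax` to both sides leaves only the diagonal on the left.
laplacian-*ᵥ G x i = +-cancelʳ (sum Ax) ((laplacian G *ᵥ x) i) (sum A∇x) (begin
  (laplacian G *ᵥ x) i ℚ.+ sum Ax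
    ≡⟨ ∑-distrib-+ (λ j → laplacian G i j ℚ.* x j) Ax ⟨
  sum (λ j → (D i j - A i j) ℚ.* x j ℚ.+ A i j ℚ.* x j)
    ≡⟨ sum-cong-≗ diagonal ⟩
  sum (λ j → (fromℕ (degree G i) ℚ.* x j) ℚ.* δ j i)
    ≡⟨ sum-δ (λ j → fromℕ (degree G i) ℚ.* x j) i ⟩
  fromℕ (degree G i) ℚ.* x i
    ≡⟨ cong (ℚ._* x i) (fromℕ-count (adj? G i)) ⟩
  sum (A i) ℚ.* x i
    ≡⟨ *-distribʳ-sum (x i) (A i) ⟩
  sum (λ j → A i j ℚ.* x i)
    ≡⟨ sum-cong-≗ (λ j → solve 3 (λ a y z → a :* y := a :* (y :- z) :+ a :* z) refl
                           (A i j) (x i) (x j)) ⟩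
  sum (λ j → A i j ℚ.* (x i - x j) ℚ.+ A i j ℚ.* x j)
    ≡⟨ ∑-distrib-+ A∇x Ax ⟩
  sum A∇x ℚ.+ sum Ax
    ∎)
  where
  open ≡-Reasoning
  A = adjacencyMatrix G
  D = degreeMatrix G

  Ax A∇x : Vector ℚ _
  Ax  j = A i j ℚ.* x j
  A∇x j = A i j ℚ.* (x i - x j)

  diagonal : ∀ j → (D i j - A i j) ℚ.* x j ℚ.+ A i j ℚ.* x j ≡ (fromℕ (degree G i) ℚ.* x j) ℚ.* δ j i
  diagonal j with i ≟ᶠ j | j ≟ᶠ i
  ... | yes i≡j | no j≢i  = contradiction (sym i≡j) j≢i
  ... | no i≢j  | yes j≡i = contradiction (sym j≡i) i≢j
  ... | yes _   | yes _   = solve 3 (λ d a y → (d :- a) :* y :+ a :* y := (d :* y) :* con 1ℚ) refl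
                              (fromℕ (degree G i)) (A i j) (x j)
  ... | no _    | no _    = solve 3 (λ d a y → (con 0ℚ :- a) :* y :+ a :* y := (d :* y) :* con 0ℚ) refl
                              (fromℕ (degree G i)) (A i j) (x j)

record IsEigenvector (M : Matrix n) (μ : ℚ) (x : Vector ℚ n) : Set where
  constructor isEigenvector
  field
    equation : ∀ i → (M *ᵥ x) i ≡ μ ℚ.* x i

open IsEigenvector

scaleEigenvector : ∀ {M : Matrix n} {μ x} c → IsEigenvector M μ x →
                   IsEigenvector M μ (λ i → c ℚ.* x i)
scaleEigenvector {M = M} {μ} {x} c e = isEigenvector λ i → begin
  sum (λ j → M i j ℚ.* (c ℚ.* x j))  ≡⟨ sum-cong-≗ (λ j → swapˡ (M i j) c (x j)) ⟩
  sum (λ j → c ℚ.* (M i j ℚ.* x j))  ≡⟨ *-distribˡ-sum c (λ j → M i j ℚ.* x j) ⟨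
  c ℚ.* (M *ᵥ x) i                   ≡⟨ cong (c ℚ.*_) (equation e i) ⟩
  c ℚ.* (μ ℚ.* x i)                  ≡⟨ swapˡ c μ (x i) ⟩
  μ ℚ.* (c ℚ.* x i)                  ∎
  where
  open ≡-Reasoning
  swapˡ : ∀ a b c → a ℚ.* (b ℚ.* c) ≡ b ℚ.* (a ℚ.* c)
  swapˡ = solve 3 (λ a b c → a :* (b :* c) := b :* (a :* c)) refl

*-zero-cancelˡ : ∀ {c z} → c ≢ 0ℚ → c ℚ.* z ≡ 0ℚ → z ≡ 0ℚ
*-zero-cancelˡ {c} {z} c≢0 eq = begin
  z                   ≡⟨ ℚ.*-identityˡ z ⟨
  1ℚ ℚ.* z            ≡⟨ cong (ℚ._* z) (ℚ.*-inverseˡ c) ⟨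
  1/ c ℚ.* c ℚ.* z    ≡⟨ ℚ.*-assoc (1/ c) c z ⟩
  1/ c ℚ.* (c ℚ.* z)  ≡⟨ cong (1/ c ℚ.*_) eq ⟩
  1/ c ℚ.* 0ℚ         ≡⟨ ℚ.*-zeroʳ (1/ c) ⟩
  0ℚ                  ∎
  where
  open ≡-Reasoning
  instance
    _ : ℚ.NonZero c
    _ = ≢-nonZero c≢0

-- One-edge connections

module _ {n₁ n₂} (G₁ : Graph (Fin n₁)) (G₂ : Graph (Fin n₂)) (u : Fin n₁) (v : Fin n₂) where

  private
    G = oneEdgeConnection G₁ G₂ u v

  -- In difference form, a row of the connection is a row of one of the two graphs, plus at `u` and
  -- `v` one term for the new edge; that term vanishes as the values at its ends agree.
  connectionEigenvector : ∀ {μ x₁ x₂} →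
    IsEigenvector (laplacian G₁) μ x₁ → IsEigenvector (laplacian G₂) μ x₂ →
    x₁ u ≡ x₂ v → IsEigenvector (laplacian G) μ ([ x₁ , x₂ ] ∘ splitAt n₁)
  connectionEigenvector {μ} {x₁} {x₂} e₁ e₂ x₁u≡x₂v = isEigenvector λ i → begin
    (laplacian G *ᵥ (x ∘ splitAt n₁)) i                              ≡⟨ laplacian-*ᵥ G (x ∘ splitAt n₁) i ⟩
    sum (λ j → h (splitAt n₁ i) (splitAt n₁ j))                      ≡⟨ sum-splitAt n₁ (h (splitAt n₁ i)) ⟩
    sum (h (splitAt n₁ i) ∘ inj₁) ℚ.+ sum (h (splitAt n₁ i) ∘ inj₂)  ≡⟨ blocks (splitAt n₁ i) ⟩
    μ ℚ.* x (splitAt n₁ i)                                           ∎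
    where
    open ≡-Reasoning
    x : Fin n₁ ⊎ Fin n₂ → ℚ
    x = [ x₁ , x₂ ]

    h : (a b : Fin n₁ ⊎ Fin n₂) → ℚ
    h a b = indicator (adj? (connection G₁ G₂ u v _≟ᶠ_ _≟ᶠ_) a b) ℚ.* (x a - x b)

    h₁₂≡0 : ∀ a b → h (inj₁ a) (inj₂ b) ≡ 0ℚ
    h₁₂≡0 a b with a ≟ᶠ u | b ≟ᶠ v
    ... | yes refl | yes refl = cong (1ℚ ℚ.*_) (trans (cong (_- x₂ b) x₁u≡x₂v) (ℚ.+-inverseʳ (x₂ b)))
    ... | yes _    | no _     = ℚ.*-zeroˡ (x₁ a - x₂ b)
    ... | no _     | _        = ℚ.*-zeroˡ (x₁ a - x₂ b)

    h₂₁≡0 : ∀ b a → h (inj₂ b) (inj₁ a) ≡ 0ℚ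
    h₂₁≡0 b a with a ≟ᶠ u | b ≟ᶠ v
    ... | yes refl | yes refl = cong (1ℚ ℚ.*_) (trans (cong (λ z → x₂ b - z) x₁u≡x₂v) (ℚ.+-inverseʳ (x₂ b)))
    ... | yes _    | no _     = ℚ.*-zeroˡ (x₂ b - x₁ a)
    ... | no _     | _        = ℚ.*-zeroˡ (x₂ b - x₁ a)

    blocks : ∀ a → sum (h a ∘ inj₁) ℚ.+ sum (h a ∘ inj₂) ≡ μ ℚ.* x a
    blocks (inj₁ a) = trans
      (cong₂ ℚ._+_ (trans (sym (laplacian-*ᵥ G₁ x₁ a)) (equation e₁ a)) (sum-zero (h₁₂≡0 a)))
      (ℚ.+-identityʳ _)
    blocks (inj₂ b) = trans
      (cong₂ ℚ._+_ (sum-zero (h₂₁≡0 b)) (trans (sym (laplacian-*ᵥ G₂ x₂ b)) (equation e₂ b)))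
      (ℚ.+-identityˡ _)

  connectionEigenvalue : ∀ {μ} → IsEigenvalue (laplacian G₁) μ → IsEigenvalue (laplacian G₂) μ →
                         IsEigenvalue (laplacian G) μ
  connectionEigenvalue {μ} (x₁ , (i , x₁i≢0) , e₁) (x₂ , (j , x₂j≢0) , e₂) = go (x₁ u ℚ.≟ 0ℚ)
    where
    go : Dec (x₁ u ≡ 0ℚ) → IsEigenvalue (laplacian G) μ
    -- Both ends carry 0, and the nonzero entry comes from `x₁`.
    go (yes x₁u≡0) =
      [ x₁ , y₂ ] ∘ splitAt n₁
      , (i ↑ˡ n₂ , λ eq → x₁i≢0 (trans (sym (cong [ x₁ , y₂ ] (splitAt-↑ˡ n₁ i n₂))) eq))
      , equation (connectionEigenvector {μ} (isEigenvector e₁)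
          (scaleEigenvector 0ℚ (isEigenvector e₂)) (trans x₁u≡0 (sym (ℚ.*-zeroˡ (x₂ v)))))
      where
      y₂ : Vector ℚ n₂
      y₂ k = 0ℚ ℚ.* x₂ k
    -- Cross-multiplying makes both ends carry `x₁ u * x₂ v` without division. The value `x₂ v` may
    -- be 0, so the nonzero entry is taken from `x₂`, whose factor `x₁ u` is nonzero.
    go (no x₁u≢0) =
      [ y₁ , y₂ ] ∘ splitAt n₁
      , (n₁ ↑ʳ j , λ eq → x₂j≢0 (*-zero-cancelˡ x₁u≢0
          (trans (sym (cong [ y₁ , y₂ ] (splitAt-↑ʳ n₁ n₂ j))) eq)))
      , equation (connectionEigenvector {μ} (scaleEigenvector (x₂ v) (isEigenvector e₁))
          (scaleEigenvector (x₁ u) (isEigenvector e₂)) (ℚ.*-comm (x₂ v) (x₁ u)))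
      where
      y₁ : Vector ℚ n₁
      y₁ k = x₂ v ℚ.* x₁ k
      y₂ : Vector ℚ n₂
      y₂ k = x₁ u ℚ.* x₂ k

-- The eigenvector of a closed walk

-- The sequence 0, 1, 0, -1 of period 4, that is, the sine of `d` quarter turns.
w : ℕ → ℚ
w 0             = 0ℚ
w 1             = 1ℚ
w (suc (suc d)) = - w d

w-period : ∀ q d → w (q ℕ.* 4 + d) ≡ w d
w-period zero    d = refl
w-period (suc q) d = trans (neg-involutive (w (q ℕ.* 4 + d))) (w-period q d)

w-even : ∀ d → d % 2 ≡ 0 → w d ≡ 0ℚ
w-even 0             _    = refl
w-even (suc (suc d)) even = cong -_ (w-even d even)

-- The summand lives on all of ℕ, so that its argument can be shifted past `n`.
∑< : ℕ → (ℕ → ℚ) → ℚ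
∑< n F = sum {n} λ d → F (toℕ d)

-- Both sides are the sum of `F 0` up to `F n`.
∑<-shift : ∀ n (F : ℕ → ℚ) → ∑< n (λ d → F (suc d)) ℚ.+ F 0 ≡ ∑< n F ℚ.+ F n
∑<-shift zero    F = refl
∑<-shift (suc n) F = begin
  F 1 ℚ.+ S₂ ℚ.+ F 0          ≡⟨ solve 3 (λ a s b → a :+ s :+ b := b :+ (s :+ a)) refl (F 1) S₂ (F 0) ⟩
  F 0 ℚ.+ (S₂ ℚ.+ F 1)        ≡⟨ cong (F 0 ℚ.+_) (∑<-shift n (λ d → F (suc d))) ⟩
  F 0 ℚ.+ (S₁ ℚ.+ F (suc n))  ≡⟨ ℚ.+-assoc (F 0) S₁ (F (suc n)) ⟨
  F 0 ℚ.+ S₁ ℚ.+ F (suc n)    ∎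
  where
  open ≡-Reasoning
  S₁ = ∑< n (λ d → F (suc d))
  S₂ = ∑< n (λ d → F (suc (suc d)))

∑<-periodic : ∀ n (F : ℕ → ℚ) → F n ≡ F 0 → ∑< n (λ d → F (suc d)) ≡ ∑< n F
∑<-periodic n F eq = +-cancelʳ (F 0) (∑< n (λ d → F (suc d))) (∑< n F)
  (trans (∑<-shift n F) (cong (∑< n F ℚ.+_) eq))

module _ (G : Graph (Fin n)) {a b q} (deg≡2 : degree G q ≡ 2) (a≢b : a ≢ b)
         (qa : Adj G q a) (qb : Adj G q b) where

  adjacencyMatrix-column : ∀ i → adjacencyMatrix G i q ≡ δ i a ℚ.+ δ i b
  adjacencyMatrix-column i with i ≟ᶠ a | i ≟ᶠ b
  ... | yes refl | yes refl = contradiction refl a≢b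
  ... | yes refl | no _     = indicator-true (adj? G i q) (adj-sym G qa)
  ... | no _     | yes refl = indicator-true (adj? G i q) (adj-sym G qb)
  ... | no i≢a   | no i≢b   = indicator-false (adj? G i q) λ iq →
    [ i≢a , i≢b ] (count≡2⇒ (adj? G q) deg≡2 qa qb a≢b (adj-sym G iq))

  -- As `q` has degree 2, `a` and `b` exhaust its neighbours, so the whole column is known whatever
  -- the rest of the graph looks like.
  laplacian-column : ∀ i → laplacian G i q ≡ fromℕ 2 ℚ.* δ i q - (δ i a ℚ.+ δ i b)
  laplacian-column i = cong₂ _-_ degreeMatrix-column (adjacencyMatrix-column i)
    where
    degreeMatrix-column : degreeMatrix G i q ≡ fromℕ 2 ℚ.* δ i q
    degreeMatrix-column with i ≟ᶠ q
    ... | yes refl = cong fromℕ deg≡2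
    ... | no _     = refl

parity : ∀ d → d % 2 ≡ 0 ⊎ d % 2 ≡ 1
parity 0             = inj₁ refl
parity 1             = inj₂ refl
parity (suc (suc d)) = parity d

-- The cycle enters as a closed walk unrolled over ℕ, so that the next position is a plain
-- successor. Periodicity of `w` expresses that 4 divides `g`; `p-noReturn` makes the two walk
-- neighbours of a position distinct.
module _ (G : Graph (Fin n)) (p : ℕ → Fin n) {g : ℕ} (0<g : 0 < g)
         (w-period   : ∀ d → w (g + d) ≡ w d)
         (p-period   : ∀ d → p (g + d) ≡ p d)
         (p-adj      : ∀ d → Adj G (p d) (p (suc d)))
         (p-first    : ∀ d → d < g → p (suc d) ≡ p 1 → d ≡ 0)
         (p-noReturn : ∀ d → p d ≢ p (suc (suc d)))
         (p-degree   : ∀ d → d < g → suc d % 2 ≡ 1 → degree G (p (suc d)) ≡ 2)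
         where

  private
    L = laplacian G

    -- `X i d` is the share of position `d + 1` in entry `i`, and `F i d` puts the same weight on
    -- position `d`. Since `w (d + 3)` is `- w (d + 1)`, `F i (d + 2)` is minus that weight on
    -- position `d + 2`: one family serves both neighbours. Starting at position 1 makes every
    -- predecessor available without subtraction.
    X F : Fin n → ℕ → ℚ
    X i d = w (suc d) ℚ.* δ i (p (suc d))
    F i d = w (suc d) ℚ.* δ i (p d)

  alternatingVector : Vector ℚ n
  alternatingVector i = ∑< g (X i)

  -- This shows that the vector is nonzero: by `p-first` only the first summand lives at `p 1`, with
  -- weight `w 1`.
  alternatingVector-p1 : alternatingVector (p 1) ≡ 1ℚ
  alternatingVector-p1 = go g 0<g p-first
    where
    go : ∀ g → 0 < g → (∀ d → d < g → p (suc d) ≡ p 1 → d ≡ 0) → ∑< g (X (p 1)) ≡ 1ℚ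
    go (suc g) _ first = cong₂ ℚ._+_
      (cong (1ℚ ℚ.*_) (indicator-true (p 1 ≟ᶠ p 1) refl))
      (sum-zero λ d → trans
        (cong (w (suc (suc (toℕ d))) ℚ.*_) (indicator-false (p 1 ≟ᶠ p (suc (suc (toℕ d)))) λ eq →
          contradiction (first (suc (toℕ d)) (s≤s (toℕ<n d)) (sym eq)) λ ()))
        (ℚ.*-zeroʳ (w (suc (suc (toℕ d))))))

  -- Expanded by columns, position `d + 1` contributes `2 * X i d - F i d + F i (d + 2)`. Over a
  -- full period the two sums of `F` coincide, and only the factor 2 remains.
  alternatingVector-*ᵥ : ∀ i → (L *ᵥ alternatingVector) i ≡ fromℕ 2 ℚ.* alternatingVector i
  alternatingVector-*ᵥ i =
    +-cancelʳ (∑< g (F i)) ((L *ᵥ alternatingVector) i) (fromℕ 2 ℚ.* alternatingVector i) (begin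
    (L *ᵥ alternatingVector) i ℚ.+ ∑< g (F i)
      ≡⟨ cong (ℚ._+ ∑< g (F i)) byColumns ⟩
    ∑< g C ℚ.+ ∑< g (F i)
      ≡⟨ ∑-distrib-+ {g} (λ d → C (toℕ d)) (λ d → F i (toℕ d)) ⟨
    ∑< g (λ d → C d ℚ.+ F i d)
      ≡⟨ sum-cong-≗ {g} (λ d → column (toℕ d) (toℕ<n d)) ⟩
    ∑< g (λ d → fromℕ 2 ℚ.* X i d ℚ.+ F i (suc (suc d)))
      ≡⟨ ∑-distrib-+ {g} (λ d → fromℕ 2 ℚ.* X i (toℕ d)) (λ d → F i (suc (suc (toℕ d)))) ⟩
    ∑< g (λ d → fromℕ 2 ℚ.* X i d) ℚ.+ ∑< g (λ d → F i (suc (suc d)))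
      -- The shift by 2 is undone in two shifts by 1, each closed up by periodicity.
      ≡⟨ cong₂ ℚ._+_ (sym (*-distribˡ-sum {g} (fromℕ 2) (λ d → X i (toℕ d))))
                     (trans (∑<-periodic g (λ d → F i (suc d)) (F-period 1)) (∑<-periodic g (F i) (F-period 0))) ⟩
    fromℕ 2 ℚ.* alternatingVector i ℚ.+ ∑< g (F i)
      ∎)
    where
    open ≡-Reasoning

    C : ℕ → ℚ
    C d = w (suc d) ℚ.* L i (p (suc d))

    -- The order `d + g` reduces to `suc g` and `g` for the two values of `d` used.
    F-period : ∀ d → F i (d + g) ≡ F i d
    F-period d = trans (cong (F i) (+-comm d g))
      (cong₂ ℚ._*_ (trans (cong w (sym (+-suc g d))) (w-period (suc d)))
                   (cong (δ i) (p-period d)))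

    byColumns : (L *ᵥ alternatingVector) i ≡ ∑< g C
    byColumns = begin
      sum (λ j → L i j ℚ.* ∑< g (X j))
        ≡⟨ sum-cong-≗ (λ j → *-distribˡ-sum {g} (L i j) (λ d → X j (toℕ d))) ⟩
      sum (λ j → ∑< g (λ d → L i j ℚ.* X j d))
        ≡⟨ ∑-comm {n} {g} (λ j d → L i j ℚ.* X j (toℕ d)) ⟩
      ∑< g (λ d → sum (λ j → L i j ℚ.* X j d))
        ≡⟨ sum-cong-≗ {g} (λ d → select (toℕ d)) ⟩
      ∑< g C
        ∎
      where
      select : ∀ d → sum (λ j → L i j ℚ.* X j d) ≡ C d
      select d = trans
        (sum-cong-≗ (λ j → solve 3 (λ l c e → l :* (c :* e) := (c :* l) :* e) refl
                             (L i j) (w (suc d)) (δ j (p (suc d)))))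
        (sum-δ (λ j → w (suc d) ℚ.* L i j) (p (suc d)))

    -- With `c` for `w (suc d)`, `- c` is by definition the weight in `F i (suc (suc d))`.
    odd-column : ∀ c t x y z →
      c ℚ.* (t ℚ.* y - (x ℚ.+ z)) ℚ.+ c ℚ.* x ≡ t ℚ.* (c ℚ.* y) ℚ.+ - c ℚ.* z
    odd-column = solve 5 (λ c t x y z →
      c :* (t :* y :- (x :+ z)) :+ c :* x := t :* (c :* y) :+ :- c :* z) refl

    -- At even positions the degree may be 3, but the unknown column entry `l` is multiplied by 0.
    even-column : ∀ {c} → c ≡ 0ℚ → ∀ l t x y z →
      c ℚ.* l ℚ.+ c ℚ.* x ≡ t ℚ.* (c ℚ.* y) ℚ.+ - c ℚ.* z
    even-column refl = solve 5 (λ l t x y z →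
      con 0ℚ :* l :+ con 0ℚ :* x := t :* (con 0ℚ :* y) :+ con 0ℚ :* z) refl

    column : ∀ d → d < g → C d ℚ.+ F i d ≡ fromℕ 2 ℚ.* X i d ℚ.+ F i (suc (suc d))
    column d d<g with parity (suc d)
    ... | inj₁ even = even-column (w-even (suc d) even)
      (L i (p (suc d))) (fromℕ 2) (δ i (p d)) (δ i (p (suc d))) (δ i (p (suc (suc d))))
    ... | inj₂ odd  = trans
      (cong (λ l → w (suc d) ℚ.* l ℚ.+ F i d)
        (laplacian-column G (p-degree d d<g odd) (p-noReturn d) (adj-sym G (p-adj d)) (p-adj (suc d)) i))
      (odd-column (w (suc d)) (fromℕ 2) (δ i (p d)) (δ i (p (suc d))) (δ i (p (suc (suc d)))))

  alternatingVector-eigenvalue : IsEigenvalue L (fromℕ 2)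
  alternatingVector-eigenvalue = alternatingVector
    , (p 1 , λ eq → contradiction (trans (sym alternatingVector-p1) eq) λ ()) , alternatingVector-*ᵥ

-- Broken suns

odd⇒suc-even : ∀ k → k % 2 ≡ 1 → suc k % 2 ≡ 0
odd⇒suc-even 1             _   = refl
odd⇒suc-even (suc (suc k)) odd = odd⇒suc-even k odd

*4-even : ∀ r → r ℕ.* 4 % 2 ≡ 0
*4-even zero    = refl
*4-even (suc r) = *4-even r

2≤cycleDegree : (G : Graph (Fin n)) (c : Cycle G m) → ∀ i → 2 ≤ degree G (vertex c i)
2≤cycleDegree {m = 1} G c i with s≤s () ← 3≤g c
2≤cycleDegree {m = 2} G c i with s≤s (s≤s ()) ← 3≤g c
2≤cycleDegree {m = suc (suc (suc m))} G c i = 2≤count (adj? G (vertex c i))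
  (preserves (embedding c) (inj₁ refl))
  (preserves (embedding c) (inj₂ i≡pred⊕1))
  -- The predecessor is reached by going forward `suc (suc m)` steps; its offset exceeds 1 by
  -- `suc m`, which is positive and below the length.
  λ eq → contradiction (⊕-cancelˡ i 1 (<-trans (n<1+n (suc m)) (n<1+n (suc (suc m))))
                          (sym (injective (embedding c) eq))) λ ()
  where
  i≡pred⊕1 : i ≡ (i ⊕ suc (suc m)) ⊕ 1
  i≡pred⊕1 = sym (begin
    (i ⊕ suc (suc m)) ⊕ 1      ≡⟨ ⊕-assoc i (suc (suc m)) 1 ⟩
    i ⊕ (suc (suc m) + 1)      ≡⟨ cong (i ⊕_) (+-suc (suc (suc m)) 0) ⟩
    i ⊕ (suc (suc (suc m)) + 0) ≡⟨ ⊕-period i 0 ⟩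
    i ⊕ 0                      ≡⟨ ⊕-identityʳ i ⟩
    i                          ∎)
    where open ≡-Reasoning

module _ (G : Graph (Fin n)) (broken : BrokenSun G) (c : Cycle G (suc m)) where

  cycleDegree : ∀ i → degree G (vertex c i) ≢ 3 → degree G (vertex c i) ≡ 2
  cycleDegree i deg≢3 with m≤n⇒m<n∨m≡n (BrokenSun⇒degree≤3 G broken (vertex c i))
  ... | inj₁ deg<3 = ≤-antisym (≤-pred deg<3) (2≤cycleDegree G c i)
  ... | inj₂ deg≡3 = contradiction deg≡3 deg≢3

  private
    degreeAt : Fin (suc m) → ℕ → ℕ
    degreeAt i d = degree G (vertex c (i ⊕ d))

  module _ (oddGaps : OddGaps G c) (i : Fin (suc m)) (D0≡3 : degreeAt i 0 ≡ 3) where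

    private
      D : ℕ → ℕ
      D = degreeAt i

    -- A scan along the cycle that remembers the last vertex of degree 3, at position `l`, and that
    -- `l` is even. At the next vertex of degree 3, the odd gap `k` gives the even step `k + 1`.
    lastThree : ∀ d → d < suc m → ∃[ l ] ∃[ k ]
      l + k ≡ d × l % 2 ≡ 0 × D l ≡ 3 × (∀ j → j < k → D (l + suc j) ≢ 3)
    lastThree zero    d<g = 0 , 0 , refl , refl , D0≡3 , λ _ ()
    lastThree (suc d) d<g with lastThree d (<-trans (n<1+n d) d<g) | D (suc d) ≟ 3
    ... | l , k , l+k≡d , l-even , Dl≡3 , gap | no D≢3 =
      l , suc k , l+suck≡sucd , l-even , Dl≡3 , gap′
      where
      l+suck≡sucd : l + suc k ≡ suc d
      l+suck≡sucd = trans (+-suc l k) (cong suc l+k≡d)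

      gap′ : ∀ j → j < suc k → D (l + suc j) ≢ 3
      gap′ j j<suck with m≤n⇒m<n∨m≡n (≤-pred j<suck)
      ... | inj₁ j<k  = gap j j<k
      ... | inj₂ refl = subst (λ e → D e ≢ 3) (sym l+suck≡sucd) D≢3
    ... | l , k , l+k≡d , l-even , Dl≡3 , gap | yes D≡3 =
      suc d , 0 , +-identityʳ (suc d) , sucd-even , D≡3 , λ _ ()
      where
      l+suck≡sucd : l + suc k ≡ suc d
      l+suck≡sucd = trans (+-suc l k) (cong suc l+k≡d)

      deg-⊕ : ∀ j → degree G (vertex c ((i ⊕ l) ⊕ j)) ≡ D (l + j)
      deg-⊕ j = cong (degree G ∘ vertex c) (⊕-assoc i l j)

      noThree : ∀ (j : Fin k) → degree G (vertex c ((i ⊕ l) ⊕ suc (toℕ j))) ≢ 3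
      noThree j eq = gap (toℕ j) (toℕ<n j) (trans (sym (deg-⊕ (suc (toℕ j)))) eq)

      -- All `k` vertices in the gap have degree 2, so the count in `OddGaps` is `k` itself.
      k-odd : k % 2 ≡ 1
      k-odd = trans
        (cong (_% 2) (sym (count-all (λ j → degree G (vertex c ((i ⊕ l) ⊕ suc (toℕ j))) ≟ 2)
          (λ j → cycleDegree ((i ⊕ l) ⊕ suc (toℕ j)) (noThree j)))))
        (oddGaps (i ⊕ l) k
          -- The gap ends at `suc d`, before the scan has gone once round, so `suc k` is below the
          -- length.
          (≤-trans (s≤s (≤-trans (m≤n+m (suc k) l) (≤-reflexive l+suck≡sucd))) d<g)
          Dl≡3 (trans (deg-⊕ (suc k)) (trans (cong D l+suck≡sucd) D≡3)) noThree)

      sucd-even : suc d % 2 ≡ 0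
      sucd-even = trans (cong (_% 2) (sym l+suck≡sucd)) (trans (%-distribˡ-+ l (suc k) 2)
        (cong₂ (λ a b → (a + b) % 2) l-even (odd⇒suc-even k k-odd)))

    -- If the degree were 3, the last such position up to `d` would be `d` itself, and hence even.
    odd⇒D≡2 : ∀ d → d < suc m → d % 2 ≡ 1 → D d ≡ 2
    odd⇒D≡2 d d<g d-odd = cycleDegree (i ⊕ d) λ D≡3 → absurd D≡3 (lastThree d d<g)
      where
      absurd : D d ≡ 3 → ¬ (∃[ l ] ∃[ k ]
        l + k ≡ d × l % 2 ≡ 0 × D l ≡ 3 × (∀ j → j < k → D (l + suc j) ≢ 3))
      absurd D≡3 (l , zero , l+0≡d , l-even , _ , _)
        with () ← trans (sym l-even) (trans (cong (_% 2) (trans (sym (+-identityʳ l)) l+0≡d)) d-odd)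
      absurd D≡3 (l , suc k , eq , _ , _ , gap) = gap k ≤-refl (trans (cong D eq) D≡3)

  oddDegrees : OddGaps G c → ∃[ i ] ∀ d → d < suc m → d % 2 ≡ 1 → degreeAt i d ≡ 2
  oddDegrees oddGaps with any? (λ i → degree G (vertex c i) ≟ 3)
  ... | yes (i , deg≡3) =
    i , odd⇒D≡2 oddGaps i (trans (cong (degree G ∘ vertex c) (⊕-identityʳ i)) deg≡3)
  ... | no ∄deg≡3 = zero , λ d _ _ → cycleDegree (zero ⊕ d) λ eq → ∄deg≡3 (zero ⊕ d , eq)

brokenSunEigenvalue : ∀ {g} (G : Graph (Fin n)) → BrokenSun G → (c : Cycle G g) → g % 4 ≡ 0 →
                      OddGaps G c → IsEigenvalue (laplacian G) (fromℕ 2)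
brokenSunEigenvalue {n} {g} G broken c g%4≡0 oddGaps = go (m%n≡0⇒n∣m g 4 g%4≡0) c oddGaps
  where
  go : ∀ {g} → 4 ∣ g → (c : Cycle G g) → OddGaps G c → IsEigenvalue (laplacian G) (fromℕ 2)
  go (divides-refl zero)    c _       with () ← 3≤g c
  -- The girth is now literally `suc r * 4`: it reduces to a successor, as the lemmas on `⊕`
  -- require, and has the shape of `w-period`.
  go (divides-refl (suc r)) c oddGaps =
    alternatingVector-eigenvalue G p (s≤s z≤n) (w-period (suc r)) p-period p-adj p-first p-noReturn p-degree
    where
    i : Fin (suc r ℕ.* 4)
    i = proj₁ (oddDegrees G broken c oddGaps)

    p : ℕ → Fin n
    p d = vertex c (i ⊕ d)

    p-adj : ∀ d → Adj G (p d) (p (suc d))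
    p-adj d = preserves (embedding c) (inj₁ (sym
      (trans (⊕-assoc i d 1) (cong (i ⊕_) (+-comm d 1)))))

    p-period : ∀ d → p (suc r ℕ.* 4 + d) ≡ p d
    p-period d = cong (vertex c) (⊕-period i d)

    p-first : ∀ d → d < suc r ℕ.* 4 → p (suc d) ≡ p 1 → d ≡ 0
    p-first d d<g eq = ⊕-cancelˡ i 1 d<g (injective (embedding c) eq)

    p-noReturn : ∀ d → p d ≢ p (suc (suc d))
    p-noReturn d eq = contradiction
      (⊕-cancelˡ i d {2} (s≤s (s≤s (s≤s z≤n)))
        (trans (cong (i ⊕_) (+-comm d 2)) (sym (injective (embedding c) eq)))) λ ()

    p-degree : ∀ d → d < suc r ℕ.* 4 → suc d % 2 ≡ 1 → degree G (p (suc d)) ≡ 2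
    p-degree d d<g odd with m≤n⇒m<n∨m≡n d<g
    ... | inj₁ sucd<g = proj₂ (oddDegrees G broken c oddGaps) (suc d) sucd<g odd
    -- The positions `suc d` run from 1 to the girth; the last one lies outside the range of
    -- `oddDegrees`, but it is even.
    ... | inj₂ sucd≡g with () ← trans (sym odd) (trans (cong (_% 2) sucd≡g) (*4-even (suc r)))

theorem14 : ∀ {n₁ n₂ g₁ g₂ : ℕ} (G₁ : Graph (Fin n₁)) (G₂ : Graph (Fin n₂)) →
    BrokenSun G₁ → BrokenSun G₂ →
    (c₁ : Cycle G₁ g₁) (c₂ : Cycle G₂ g₂) →
    ¬ PerfectMatching G₁ → ¬ PerfectMatching G₂ →
    g₁ % 4 ≡ 0 → g₂ % 4 ≡ 0 →
    OddGaps G₁ c₁ → OddGaps G₂ c₂ →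
    ∀ (u : Fin n₁) (v : Fin n₂) →
    IsEigenvalue (laplacian (oneEdgeConnection G₁ G₂ u v)) (fromℕ 2)
theorem14 G₁ G₂ broken₁ broken₂ c₁ c₂ _ _ 4∣g₁ 4∣g₂ oddGaps₁ oddGaps₂ u v =
  connectionEigenvalue G₁ G₂ u v {fromℕ 2}
    (brokenSunEigenvalue G₁ broken₁ c₁ 4∣g₁ oddGaps₁)
    (brokenSunEigenvalue G₂ broken₂ c₂ 4∣g₂ oddGaps₂)
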